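{- Let $\pi,\tau\in\mathfrak{S}_m$. If $\mathcal{O}_\pi=\mathcal{O}_\tau$ and, for all $i\in\mathcal{O}_\pi$, we have $\{\pi_1,\dots,\pi_{m-i}\}=\{\tau_1,\dots,\tau_{m-i}\}$ and $\{\pi_{i+1},\dots,\pi_m\}=\{\tau_{i+1},\dots,\tau_m\}$, then $\pi$ and $\tau$ are super-strongly c-Wilf equivalent.
   Context: $\mathfrak{S}_n$ is the symmetric group on $[n]$, permutations written $\sigma=\sigma_1\cdots\sigma_n$. The standardization $\operatorname{st}(w)$ of a word of distinct integers replaces its smallest entry by 1, the next smallest by 2, etc. For $\pi\in\mathfrak{S}_m$ and $\sigma\in\mathfrak{S}_n$, $\operatorname{Em}(\pi,\sigma)=\{i\in[n-m+1]:\operatorname{st}(\sigma_i\cdots\sigma_{i+m-1})=\pi\}$. For a set $S$ of positive integers, $a^\pi_{n,S}$ is the number of $\sigma\in\mathfrak{S}_n$ with $\operatorname{Em}(\pi,\sigma)=S$; $\pi$ and $\tau$ are super-strongly c-Wilf equivalent if $a^\pi_{n,S}=a^\tau_{n,S}$ for all $n$ and all $S$. The overlap set of $\pi\in\mathfrak{S}_m$ is $\mathcal{O}_\pi=\{i\in[m-1]:\operatorname{st}(\pi_{i+1}\cdots\pi_m)=\operatorname{st}(\pi_1\cdots\pi_{m-i})\}$. -}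

module Defs where

open import Data.Fin.Base using (toℕ)
open import Data.Fin.Permutation using (Permutation′; _⟨$⟩ʳ_; _≈_)
open import Data.List.Base using (List; length; map; filter; tabulate; take; drop)
open import Data.List.Membership.Propositional using (_∈_)
open import Data.List.Relation.Unary.AllPairs using (AllPairs)
open import Data.List.Relation.Unary.Any using (Any)
open import Data.Nat.Base using (ℕ; suc; pred; _+_; _∸_; _≤_; _<_)
open import Data.Nat.Properties using (_≤?_)
open import Data.Product.Base using (_×_; ∃-syntax)
open import Function.Bundles using (_⇔_)
open import Level using (0ℓ)
open import Relation.Binary.PropositionalEquality.Core using (_≡_)
open import Relation.Nullary.Negation.Core using (¬_)
open import Relation.Unary using (Pred; _≐_; _⊆_)

-- One-line notation with entries in {1,…,n}; Fin n is {0,…,n-1}, hence the suc.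
word : ∀ {n} → Permutation′ n → List ℕ
word σ = tabulate (λ j → suc (toℕ (σ ⟨$⟩ʳ j)))

-- w [ a ⋯ b ] is the factor w_a w_{a+1} ⋯ w_b, with positions counted from 1
-- (only used with a ≥ 1); it is empty when b < a.
infix 30 _[_⋯_]
_[_⋯_] : List ℕ → ℕ → ℕ → List ℕ
w [ a ⋯ b ] = take (suc b ∸ a) (drop (pred a) w)

-- In a word of distinct integers, the k-th smallest entry is the entry x
-- for which exactly k entries are ≤ x.
st : List ℕ → List ℕ
st w = map (λ x → length (filter (_≤? x) w)) w

letters : List ℕ → Pred ℕ 0ℓ
letters w x = x ∈ w

-- i ∈ [n-m+1] is written without subtraction, so that n < m gives the empty set.
Em : ∀ {m n} → Permutation′ m → Permutation′ n → Pred ℕ 0ℓ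
Em {m} {n} π σ i =
  (1 ≤ i × i + m ≤ n + 1) × st (word σ [ i ⋯ (i + m) ∸ 1 ]) ≡ word π

𝒪 : ∀ {m} → Permutation′ m → Pred ℕ 0ℓ
𝒪 {m} π i =
  (1 ≤ i × i ≤ m ∸ 1) × st (word π [ i + 1 ⋯ m ]) ≡ st (word π [ 1 ⋯ m ∸ i ])

-- P has exactly k elements: they can be listed without repetition in a list of
-- length k. Permutations are compared by _≈_, equality of their values, since
-- propositional equality of Permutation′ n also compares the inverses and the
-- proof components.
HasCardinality : ∀ {n} → Pred (Permutation′ n) 0ℓ → ℕ → Set
HasCardinality {n} P k =
  ∃[ σs ] length σs ≡ k
        × AllPairs (λ σ ρ → ¬ σ ≈ ρ) σs
        × (∀ (σ : Permutation′ n) → P σ ⇔ Any (σ ≈_) σs)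

-- "a^π_{n,S} = k". It is a relation rather than a function to ℕ because S is
-- arbitrary (possibly infinite), so Em π σ ≐ S need not be decidable.
a[_,_,_]≡_ : ∀ {m} → Permutation′ m → ℕ → Pred ℕ 0ℓ → ℕ → Set
a[ π , n , S ]≡ k = HasCardinality {n} (λ σ → Em π σ ≐ S) k

-- Equality of the numbers a^π_{n,S} and a^τ_{n,S}: they take the same value k.
SuperStronglyCWilfEquivalent : ∀ {m} → Permutation′ m → Permutation′ m → Set₁
SuperStronglyCWilfEquivalent π τ =
  ∀ (n : ℕ) (S : Pred ℕ 0ℓ) → S ⊆ (1 ≤_) →
  ∀ (k : ℕ) → a[ π , n , S ]≡ k ⇔ a[ τ , n , S ]≡ k

{-# OPTIONS --safe #-}
module Submission where

-- Let h be the permutation of positions with τ = π ∘ h. The hypotheses force h (d + k) = d + h k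
-- for every overlap d of π. So if all the positions in T are occurrences of π in σ, applying h
-- inside each of these windows is consistent on their intersections, and it gives a permutation γ
-- of [n], depending on T only, such that all the positions in T are occurrences of τ in σ ∘ γ.
-- Since σ ↦ σ ∘ γ is injective and the roles of π and τ can be exchanged, the permutations with
-- Em ⊇ T are equally many for π and for τ. Inclusion–exclusion, in the form
--   #{Em ⊇ T, Em ∩ (V ∪ {v}) = ∅} = #{Em ⊇ T, Em ∩ V = ∅} − #{Em ⊇ T ∪ {v}, Em ∩ V = ∅},
-- extends this to Em = S.

open import Defs
open import Data.Fin.Base using (Fin; zero; suc; punchIn; toℕ; fromℕ<)
open import Data.Fin.Permutation
  using (Permutation′; _⟨$⟩ʳ_; _≈_; id; insert; remove; punchIn-permute; flip; _∘ₚ_; inverseˡ;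
    inverseʳ; permutation)
import Data.Fin.Properties as Fin
open import Data.List.Base
  using (List; []; _∷_; length; filter; lookup; allFin; cartesianProductWith; deduplicate; map;
    tabulate; applyUpTo; upTo; take; drop)
open import Data.List.Membership.Propositional using (_∈_; find; lose)
open import Data.List.Membership.Propositional.Properties
  using (∈-allFin; ∈-applyUpTo⁺; ∈-applyUpTo⁻; ∈-upTo⁺; ∈-filter⁺)
open import Data.List.Membership.Propositional.Properties.WithK using (unique∧set⇒bag)
open import Data.List.Membership.Setoid.Properties
  using (∈-lookup; ∈-filter⁻; ∈-deduplicate⁺) renaming (∈-filter⁺ to ∈ₛ-filter⁺)
open import Data.List.Properties
  using (map-∘; map-applyUpTo; map-upTo; map-cong-local; drop-map; take-map; ∷-injectiveˡ;
    ∷-injectiveʳ; ≡-dec; tabulate-cong)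
open import Data.List.Relation.Binary.BagAndSetEquality using (∼bag⇒↭)
open import Data.List.Relation.Binary.Permutation.Propositional using (_↭_)
open import Data.List.Relation.Binary.Permutation.Propositional.Properties
  using (filter-↭; ↭-length; map⁺)
open import Data.List.Relation.Unary.All using ([]; _∷_; All)
import Data.List.Relation.Unary.All as All
open import Data.List.Relation.Unary.All.Properties using (drop⁺; take⁺; all-filter)
open import Data.List.Relation.Unary.AllPairs using ([]; _∷_)
open import Data.List.Relation.Unary.Any using (Any; here; there; index)
import Data.List.Relation.Unary.Any as Any
open import Data.List.Relation.Unary.Any.Properties using (lookup-index; cartesianProductWith⁺)
open import Data.List.Relation.Unary.Unique.DecSetoid.Properties using (deduplicate-!)
open import Data.List.Relation.Unary.Unique.Propositional using (Unique)
open import Data.List.Relation.Unary.Unique.Propositional.Properties using (applyUpTo⁺₁; upTo⁺)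
open import Data.List.Relation.Unary.Unique.Setoid using () renaming (Unique to Uniqueₛ)
open import Data.List.Relation.Unary.Unique.Setoid.Properties using (filter⁺)
open import Data.Nat.Base using (ℕ; zero; suc; _+_; _∸_; _≤_; pred; _<_; z≤n; s≤s; z<s; s<s; s≤s⁻¹)
open import Data.Nat.Properties
  using (suc-injective; _≟_; ≤-reflexive; ≤-refl; ≤-antisym; ≤-trans; _≤?_; ≤-total; m≤n⇒m≤1+n;
    <⇒≤; <⇒≢; <⇒≱; ≮⇒≥; <-trans; ≤-<-trans; <-≤-trans; _<?_; +-suc; +-assoc; +-comm;
    +-cancelˡ-≡; +-cancelˡ-<; m≤m+n; m+n≤o⇒m≤o; +-monoʳ-<; m∸n≤m; ∸-monoˡ-≤; m+n∸m≡n; m+[n∸m]≡n)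
open import Data.Product.Base using (_×_; _,_; proj₁; proj₂; ∃; ∃-syntax; swap)
import Data.Product.Base as Product
open import Data.Sum.Base using (inj₁; inj₂)
open import Function.Base using (_∘_)
open import Function.Bundles using (_⇔_; mk⇔; Equivalence)
open import Level using (0ℓ)
open import Relation.Binary.Bundles using (Setoid; DecSetoid)
open import Relation.Binary.Definitions using (_Respects_)
open import Relation.Binary.PropositionalEquality
  using (_≡_; refl; sym; trans; cong; subst; cong₂; subst₂; module ≡-Reasoning)
open import Relation.Nullary.Decidable using (yes; no; ¬?; Dec; map′; _×-dec_; decidable-stable)
open import Relation.Nullary.Negation using (¬_; contradiction)
open import Relation.Unary using (Pred; Decidable; _≐_; _∩_; ∁; U; _⊆_)

-- Enumeration and cardinality of sets of permutations

module _ (S : Setoid 0ℓ 0ℓ) where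

  open Setoid S using () renaming (Carrier to A; _≈_ to _≈ₛ_; sym to symₛ; trans to transₛ)

  lookup-distinct : ∀ {xs : List A} → Uniqueₛ S xs → ∀ i j → lookup xs i ≈ₛ lookup xs j → i ≡ j
  lookup-distinct (_ ∷ _) zero zero _ = refl
  lookup-distinct {_ ∷ xs} (x≉ ∷ _) zero (suc j) eq =
    contradiction eq (All.lookupₛ S (λ y≈z x≉y x≈z → x≉y (transₛ x≈z (symₛ y≈z))) x≉ (∈-lookup S xs j))
  lookup-distinct {_ ∷ xs} (x≉ ∷ _) (suc i) zero eq =
    contradiction (symₛ eq) (All.lookupₛ S (λ y≈z x≉y x≈z → x≉y (transₛ x≈z (symₛ y≈z))) x≉ (∈-lookup S xs i))
  lookup-distinct (_ ∷ xs!) (suc i) (suc j) eq = cong suc (lookup-distinct xs! i j eq)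

permDecSetoid : ℕ → DecSetoid 0ℓ 0ℓ
permDecSetoid n = record
  { Carrier = Permutation′ n
  ; _≈_ = _≈_
  ; isDecEquivalence = record
    { isEquivalence = record
      { refl = λ _ → refl
      ; sym = λ eq i → sym (eq i)
      ; trans = λ eq eq′ i → trans (eq i) (eq′ i)
      }
    ; _≟_ = λ σ ρ → Fin.all? (λ i → (σ ⟨$⟩ʳ i) Fin.≟ (ρ ⟨$⟩ʳ i))
    }
  }

permSetoid : ℕ → Setoid 0ℓ 0ℓ
permSetoid n = DecSetoid.setoid (permDecSetoid n)

module _ {n : ℕ} where

  open DecSetoid (permDecSetoid n) using () renaming (sym to ≈-sym)

  module _ {P Q : Pred (Permutation′ n) 0ℓ} where

    -- Pigeonhole on indices: each listed member of `P` is sent by `f` to a member of `Q`, hence to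
    -- an index in the list of `Q`. Equal indices force equal images up to `_≈_`, and the list of
    -- `P` has no repetitions.
    HasCardinality-mono : ∀ {k l} (f : Permutation′ n → Permutation′ n) →
      (∀ {σ ρ} → f σ ≈ f ρ → σ ≈ ρ) → (∀ {σ} → P σ → Q (f σ)) →
      HasCardinality P k → HasCardinality Q l → k ≤ l
    HasCardinality-mono f f-inj P⇒Qf (σs , refl , σs! , P⇔) (ρs , refl , ρs! , Q⇔) =
      Fin.injective⇒≤ {f = λ i → index (found i)} λ {i} {j} eq →
        lookup-distinct (permSetoid n) σs! i j (f-inj λ x →
          trans (subst (λ l → f (lookup σs i) ⟨$⟩ʳ x ≡ lookup ρs l ⟨$⟩ʳ x) eq (lookup-index (found i) x))
                (sym (lookup-index (found j) x)))
      where
      found : ∀ i → Any (f (lookup σs i) ≈_) ρs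
      found i = Equivalence.to (Q⇔ _) (P⇒Qf (Equivalence.from (P⇔ _) (∈-lookup (permSetoid n) σs i)))

    HasCardinality-resp-≐ : ∀ {k} → P ≐ Q → HasCardinality P k → HasCardinality Q k
    HasCardinality-resp-≐ (P⊆Q , Q⊆P) (σs , len , σs! , P⇔) =
      σs , len , σs! , λ σ → mk⇔ (Equivalence.to (P⇔ σ) ∘ Q⊆P) (P⊆Q ∘ Equivalence.from (P⇔ σ))

    HasCardinality-∩ : ∀ {k} (Q? : Decidable Q) → Q Respects _≈_ →
      ((σs , _) : HasCardinality P k) → HasCardinality (P ∩ Q) (length (filter Q? σs))
    HasCardinality-∩ Q? Q-resp (σs , _ , σs! , P⇔) =
      filter Q? σs , refl , filter⁺ (permSetoid n) Q? σs! , λ σ → mk⇔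
        (λ (p , q) → ∈ₛ-filter⁺ (permSetoid n) Q? Q-resp (Equivalence.to (P⇔ σ) p) q)
        (λ σ∈ → let (σ∈σs , q) = ∈-filter⁻ (permSetoid n) Q? Q-resp {xs = σs} σ∈
                in Equivalence.from (P⇔ σ) σ∈σs , q)

  HasCardinality-unique : ∀ {P : Pred (Permutation′ n) 0ℓ} {k l} →
    HasCardinality P k → HasCardinality P l → k ≡ l
  HasCardinality-unique c d =
    ≤-antisym (HasCardinality-mono (λ σ → σ) (λ eq → eq) (λ p → p) c d)
              (HasCardinality-mono (λ σ → σ) (λ eq → eq) (λ p → p) d c)

  length-filter-∁ : ∀ {Q : Pred (Permutation′ n) 0ℓ} (Q? : Decidable Q) σs →
    length (filter Q? σs) + length (filter (¬? ∘ Q?) σs) ≡ length σs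
  length-filter-∁ Q? [] = refl
  length-filter-∁ Q? (σ ∷ σs) with Q? σ
  ... | yes _ = cong suc (length-filter-∁ Q? σs)
  ... | no  _ = trans (+-suc _ _) (cong suc (length-filter-∁ Q? σs))

  HasCardinality-split : ∀ {P Q : Pred (Permutation′ n) 0ℓ} {k} (Q? : Decidable Q) → Q Respects _≈_ →
    HasCardinality P k →
    ∃[ a ] ∃[ b ] HasCardinality (P ∩ Q) a × HasCardinality (P ∩ ∁ Q) b × a + b ≡ k
  HasCardinality-split Q? Q-resp c@(σs , len , _) =
    _ , _ , HasCardinality-∩ Q? Q-resp c ,
    HasCardinality-∩ (¬? ∘ Q?) (λ {σ} {ρ} eq ¬q q → ¬q (Q-resp (≈-sym {σ} {ρ} eq) q)) c ,
    trans (length-filter-∁ Q? σs) len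

-- Up to `_≈_`, a permutation of `suc n` points is determined by its value at `zero` and by its
-- `remove zero`. Only completeness is proved of this list; `HasCardinality-U` gets distinctness by
-- deduplicating.
perms : ∀ n → List (Permutation′ n)
perms zero    = id ∷ []
perms (suc n) = cartesianProductWith (insert zero) (allFin (suc n)) (perms n)

insert-cong : ∀ {n} (σ : Permutation′ (suc n)) {j} {ρ : Permutation′ n} →
  σ ⟨$⟩ʳ zero ≡ j → remove zero σ ≈ ρ → σ ≈ insert zero j ρ
insert-cong σ refl eq zero    = refl
insert-cong σ {ρ = ρ} refl eq (suc i) =
  trans (punchIn-permute σ zero i) (cong (punchIn (σ ⟨$⟩ʳ zero)) (eq i))

perms-complete : ∀ {n} (σ : Permutation′ n) → Any (σ ≈_) (perms n)
perms-complete {zero}  σ = here λ ()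
perms-complete {suc n} σ =
  cartesianProductWith⁺ (insert zero) (insert-cong σ) (∈-allFin (σ ⟨$⟩ʳ zero))
    (perms-complete (remove zero σ))

HasCardinality-U : ∀ {n} → ∃ (HasCardinality {n} U)
HasCardinality-U {n} =
  _ , deduplicate _≈?_ (perms n) , refl , deduplicate-! (permDecSetoid n) (perms n) , λ σ → mk⇔
    (λ _ → ∈-deduplicate⁺ (permSetoid n) _≈?_ (λ eq eq′ x → trans (eq′ x) (sym (eq x)))
      {z = σ} (perms-complete σ))
    (λ _ → _)
  where open DecSetoid (permDecSetoid n) using () renaming (_≟_ to _≈?_)

HasCardinality-∃ : ∀ {n} {P : Pred (Permutation′ n) 0ℓ} → Decidable P → P Respects _≈_ → ∃ (HasCardinality P)
HasCardinality-∃ P? P-resp =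
  _ , HasCardinality-resp-≐ (proj₂ , (_ ,_)) (HasCardinality-∩ P? P-resp (proj₂ HasCardinality-U))

-- Factors of words given by functions on ℕ

applyUpTo-cong : ∀ {f g : ℕ → ℕ} n → (∀ {j} → j < n → f j ≡ g j) → applyUpTo f n ≡ applyUpTo g n
applyUpTo-cong zero    eq = refl
applyUpTo-cong (suc n) eq = cong₂ _∷_ (eq z<s) (applyUpTo-cong n (eq ∘ s<s))

applyUpTo-injective : ∀ {f g : ℕ → ℕ} n → applyUpTo f n ≡ applyUpTo g n → ∀ {j} → j < n → f j ≡ g j
applyUpTo-injective (suc n) eq {zero}  _         = ∷-injectiveˡ eq
applyUpTo-injective (suc n) eq {suc j} (s<s j<n) = applyUpTo-injective n (∷-injectiveʳ eq) j<n

drop-applyUpTo : ∀ (f : ℕ → ℕ) d n → drop d (applyUpTo f n) ≡ applyUpTo (λ j → f (d + j)) (n ∸ d)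
drop-applyUpTo f zero    n       = refl
drop-applyUpTo f (suc d) zero    = refl
drop-applyUpTo f (suc d) (suc n) = drop-applyUpTo (f ∘ suc) d n

take-applyUpTo : ∀ (f : ℕ → ℕ) {k n} → k ≤ n → take k (applyUpTo f n) ≡ applyUpTo f k
take-applyUpTo f z≤n       = refl
take-applyUpTo f (s≤s k≤n) = cong (f 0 ∷_) (take-applyUpTo (f ∘ suc) k≤n)

applyUpTo-factor : ∀ (f : ℕ → ℕ) a {l n} → a + l ≤ n →
  applyUpTo f n [ suc a ⋯ a + l ] ≡ applyUpTo (λ j → f (a + j)) l
applyUpTo-factor f a {l} {n} a+l≤n = begin
  take (a + l ∸ a) (drop a (applyUpTo f n))      ≡⟨ cong₂ take (m+n∸m≡n a l) (drop-applyUpTo f a n) ⟩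
  take l (applyUpTo (λ j → f (a + j)) (n ∸ a))   ≡⟨ take-applyUpTo _ l≤n∸a ⟩
  applyUpTo (λ j → f (a + j)) l                  ∎
  where
  open ≡-Reasoning
  l≤n∸a : l ≤ n ∸ a
  l≤n∸a = subst (_≤ n ∸ a) (m+n∸m≡n a l) (∸-monoˡ-≤ a a+l≤n)

tabulate-applyUpTo : ∀ {n} {f : Fin n → ℕ} {g : ℕ → ℕ} → (∀ i → f i ≡ g (toℕ i)) → tabulate f ≡ applyUpTo g n
tabulate-applyUpTo {zero}  eq = refl
tabulate-applyUpTo {suc n} eq = cong₂ _∷_ (eq zero) (tabulate-applyUpTo (eq ∘ suc))

-- Ranks and standardization

rank : List ℕ → ℕ → ℕ
rank w x = length (filter (_≤? x) w)

module _ {P Q : Pred ℕ 0ℓ} (P? : Decidable P) (Q? : Decidable Q) (P⊆Q : P ⊆ Q) where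

  length-filter-mono : ∀ w → length (filter P? w) ≤ length (filter Q? w)
  length-filter-mono []      = z≤n
  length-filter-mono (x ∷ w) with P? x | Q? x
  ... | yes _ | yes _ = s≤s (length-filter-mono w)
  ... | yes p | no ¬q = contradiction (P⊆Q p) ¬q
  ... | no _  | yes _ = m≤n⇒m≤1+n (length-filter-mono w)
  ... | no _  | no _  = length-filter-mono w

  length-filter-strict : ∀ {w y} → y ∈ w → ¬ P y → Q y → length (filter P? w) < length (filter Q? w)
  length-filter-strict {x ∷ w} y∈w ¬Py Qy with P? x | Q? x | y∈w
  ... | yes p | _     | here refl  = contradiction p ¬Py
  ... | no _  | no ¬q | here refl  = contradiction Qy ¬q
  ... | no _  | yes _ | here refl  = s≤s (length-filter-mono w)
  ... | yes p | no ¬q | there _    = contradiction (P⊆Q p) ¬q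
  ... | yes _ | yes _ | there y∈w′ = s≤s (length-filter-strict y∈w′ ¬Py Qy)
  ... | no _  | yes _ | there y∈w′ = m≤n⇒m≤1+n (length-filter-strict y∈w′ ¬Py Qy)
  ... | no _  | no _  | there y∈w′ = length-filter-strict y∈w′ ¬Py Qy

length-filter-map : ∀ {P Q : Pred ℕ 0ℓ} (P? : Decidable P) (Q? : Decidable Q) (f : ℕ → ℕ) {w} →
  All (λ y → P (f y) ⇔ Q y) w → length (filter P? (map f w)) ≡ length (filter Q? w)
length-filter-map P? Q? f []                   = refl
length-filter-map P? Q? f {y ∷ _} (P⇔Q ∷ P⇔Qs) with P? (f y) | Q? y
... | yes _ | yes _ = cong suc (length-filter-map P? Q? f P⇔Qs)
... | yes p | no ¬q = contradiction (Equivalence.to P⇔Q p) ¬q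
... | no ¬p | yes q = contradiction (Equivalence.from P⇔Q q) ¬p
... | no _  | no _  = length-filter-map P? Q? f P⇔Qs

rank-mono : ∀ w {x y} → x ≤ y → rank w x ≤ rank w y
rank-mono w {x} {y} x≤y = length-filter-mono (_≤? x) (_≤? y) (λ z≤x → ≤-trans z≤x x≤y) w

-- The entry `y` counts itself in `rank w y`, and is not counted in `rank w x`.
rank-strict : ∀ {w x y} → y ∈ w → x < y → rank w x < rank w y
rank-strict {x = x} {y} y∈w x<y =
  length-filter-strict (_≤? x) (_≤? y) (λ z≤x → ≤-trans z≤x (<⇒≤ x<y)) y∈w (<⇒≱ x<y) ≤-refl

rank-reflects-≤ : ∀ {w x y} → x ∈ w → rank w x ≤ rank w y → x ≤ y
rank-reflects-≤ x∈w r≤r = ≮⇒≥ λ y<x → <⇒≱ (rank-strict x∈w y<x) r≤r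

rank-injective : ∀ {w x y} → x ∈ w → y ∈ w → rank w x ≡ rank w y → x ≡ y
rank-injective x∈w y∈w eq =
  ≤-antisym (rank-reflects-≤ x∈w (≤-reflexive eq)) (rank-reflects-≤ y∈w (≤-reflexive (sym eq)))

rank-↭ : ∀ {v w} → v ↭ w → ∀ x → rank v x ≡ rank w x
rank-↭ v↭w x = ↭-length (filter-↭ (_≤? x) v↭w)

unique∧set⇒↭ : ∀ {v w : List ℕ} → Unique v → Unique w → letters v ≐ letters w → v ↭ w
unique∧set⇒↭ v! w! (v⊆w , w⊆v) = ∼bag⇒↭ (unique∧set⇒bag v! w! (mk⇔ v⊆w w⊆v))

-- On entries of `w`, `rank w` preserves and reflects the order, and `st` depends on nothing but the
-- relative order of the entries.
st-map-rank : ∀ {v w} → All (_∈ w) v → st (map (rank w) v) ≡ st v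
st-map-rank {v} {w} v⊆w =
  trans (sym (map-∘ v)) (map-cong-local (All.tabulate λ {x} _ →
    length-filter-map (_≤? rank w x) (_≤? x) (rank w)
      (All.map (λ y∈w → mk⇔ (rank-reflects-≤ y∈w) (rank-mono w)) v⊆w)))

st-factor-st : ∀ w a b → st (st w [ a ⋯ b ]) ≡ st (w [ a ⋯ b ])
st-factor-st w a b = begin
  st (take (suc b ∸ a) (drop (pred a) (map (rank w) w)))  ≡⟨ cong (st ∘ take (suc b ∸ a)) (drop-map (pred a) w) ⟩
  st (take (suc b ∸ a) (map (rank w) (drop (pred a) w)))  ≡⟨ cong st (take-map (suc b ∸ a) _) ⟩
  st (map (rank w) (w [ a ⋯ b ]))                         ≡⟨ st-map-rank factor⊆w ⟩
  st (w [ a ⋯ b ])                                        ∎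
  where
  open ≡-Reasoning
  factor⊆w : All (_∈ w) (w [ a ⋯ b ])
  factor⊆w = take⁺ (suc b ∸ a) (drop⁺ (pred a) (All.tabulate λ x∈w → x∈w))

st-applyUpTo : ∀ f n → st (applyUpTo f n) ≡ applyUpTo (λ j → rank (applyUpTo f n) (f j)) n
st-applyUpTo f n = map-applyUpTo f (rank (applyUpTo f n)) n

-- Permutations as functions on ℕ

infixl 9 _⟨_⟩
-- Made total on ℕ so that positions such as `a + k` are handled by plain arithmetic, with bounds
-- supplied only where a law asks for them. From `n` on, the default is the identity.
_⟨_⟩ : ∀ {n} → Permutation′ n → ℕ → ℕ
_⟨_⟩ {n} σ j with j <? n
... | yes j<n = toℕ (σ ⟨$⟩ʳ fromℕ< j<n)
... | no  _   = j

⟨⟩-toℕ : ∀ {n} (σ : Permutation′ n) i → σ ⟨ toℕ i ⟩ ≡ toℕ (σ ⟨$⟩ʳ i)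
⟨⟩-toℕ {n} σ i with toℕ i <? n
... | yes i<n = cong (λ k → toℕ (σ ⟨$⟩ʳ k)) (Fin.fromℕ<-toℕ i i<n)
... | no  i≮n = contradiction (Fin.toℕ<n i) i≮n

⟨⟩-fromℕ< : ∀ {n} (σ : Permutation′ n) {j} (j<n : j < n) → σ ⟨ j ⟩ ≡ toℕ (σ ⟨$⟩ʳ fromℕ< j<n)
⟨⟩-fromℕ< σ j<n = trans (cong (σ ⟨_⟩) (sym (Fin.toℕ-fromℕ< j<n))) (⟨⟩-toℕ σ (fromℕ< j<n))

⟨⟩-< : ∀ {n} (σ : Permutation′ n) {j} → j < n → σ ⟨ j ⟩ < n
⟨⟩-< {n} σ j<n = subst (_< n) (sym (⟨⟩-fromℕ< σ j<n)) (Fin.toℕ<n _)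

⟨⟩-∘ₚ : ∀ {n} (σ ρ : Permutation′ n) {j} → j < n → (σ ∘ₚ ρ) ⟨ j ⟩ ≡ ρ ⟨ σ ⟨ j ⟩ ⟩
⟨⟩-∘ₚ σ ρ j<n = trans (⟨⟩-fromℕ< (σ ∘ₚ ρ) j<n) (sym (trans (cong (ρ ⟨_⟩) (⟨⟩-fromℕ< σ j<n)) (⟨⟩-toℕ ρ _)))

⟨⟩-inverse : ∀ {n} (σ : Permutation′ n) {j} → j < n → flip σ ⟨ σ ⟨ j ⟩ ⟩ ≡ j
⟨⟩-inverse σ j<n = trans (cong (flip σ ⟨_⟩) (⟨⟩-fromℕ< σ j<n))
  (trans (⟨⟩-toℕ (flip σ) _) (trans (cong toℕ (inverseˡ σ)) (Fin.toℕ-fromℕ< j<n)))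

⟨⟩-injective : ∀ {n} (σ : Permutation′ n) {j k} → j < n → k < n → σ ⟨ j ⟩ ≡ σ ⟨ k ⟩ → j ≡ k
⟨⟩-injective σ j<n k<n eq =
  trans (sym (⟨⟩-inverse σ j<n)) (trans (cong (flip σ ⟨_⟩) eq) (⟨⟩-inverse σ k<n))

letter : ∀ {n} → Permutation′ n → ℕ → ℕ
letter σ j = suc (σ ⟨ j ⟩)

word-applyUpTo : ∀ {n} (σ : Permutation′ n) → word σ ≡ applyUpTo (letter σ) n
word-applyUpTo σ = tabulate-applyUpTo λ i → cong suc (sym (⟨⟩-toℕ σ i))

-- In one-line notation this is σ_(a+1) ⋯ σ_(a+l): starting positions count from 0 here, so an
-- occurrence at `suc a` concerns `factor σ a m`.
factor : ∀ {n} → Permutation′ n → ℕ → ℕ → List ℕ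
factor σ a l = applyUpTo (λ j → letter σ (a + j)) l

word-factor : ∀ {n} (σ : Permutation′ n) a {l} → a + l ≤ n → word σ [ suc a ⋯ a + l ] ≡ factor σ a l
word-factor σ a {l} a+l≤n =
  trans (cong (_[ suc a ⋯ a + l ]) (word-applyUpTo σ)) (applyUpTo-factor (letter σ) a a+l≤n)

factor-unique : ∀ {n} (σ : Permutation′ n) a {l} → a + l ≤ n → Unique (factor σ a l)
factor-unique σ a {l} a+l≤n = applyUpTo⁺₁ _ l λ {i} {j} i<j j<l eq →
  <⇒≢ i<j (+-cancelˡ-≡ a i j (⟨⟩-injective σ
    (<-≤-trans (+-monoʳ-< a (<-trans i<j j<l)) a+l≤n) (<-≤-trans (+-monoʳ-< a j<l) a+l≤n) (suc-injective eq)))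

-- The rearrangement is found on the list of indices, where both sides are repetition-free with the
-- same elements. Mapping `f`, which may fail to be injective, then preserves it.
applyUpTo-permute : ∀ {m} (η : Permutation′ m) (f : ℕ → ℕ) →
  applyUpTo (λ j → f (η ⟨ j ⟩)) m ↭ applyUpTo f m
applyUpTo-permute {m} η f =
  subst₂ _↭_ (map-applyUpTo (η ⟨_⟩) f m) (map-upTo f m) (map⁺ f (unique∧set⇒↭
    (applyUpTo⁺₁ _ m λ i<j j<m eq → <⇒≢ i<j (⟨⟩-injective η (<-trans i<j j<m) j<m eq)) (upTo⁺ m)
    (image⊆ , ⊆image)))
  where
  image⊆ : letters (applyUpTo (η ⟨_⟩) m) ⊆ letters (upTo m)
  image⊆ x∈ with ∈-applyUpTo⁻ _ x∈
  ... | _ , j<m , refl = ∈-applyUpTo⁺ _ (⟨⟩-< η j<m)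
  ⊆image : letters (upTo m) ⊆ letters (applyUpTo (η ⟨_⟩) m)
  ⊆image x∈ with ∈-applyUpTo⁻ _ x∈
  ... | _ , j<m , refl =
    subst (_∈ applyUpTo (η ⟨_⟩) m) (⟨⟩-inverse (flip η) j<m) (∈-applyUpTo⁺ _ (⟨⟩-< (flip η) j<m))

-- Overlaps

-- Since `_∘ₚ_` applies its left argument first, this is π⁻¹ ∘ τ, the h with τ = π ∘ h.
reindex : ∀ {m} → Permutation′ m → Permutation′ m → Permutation′ m
reindex π τ = τ ∘ₚ flip π

⟨reindex⟩ : ∀ {m} (π τ : Permutation′ m) {k} → k < m → π ⟨ reindex π τ ⟨ k ⟩ ⟩ ≡ τ ⟨ k ⟩
⟨reindex⟩ π τ k<m = trans (cong (π ⟨_⟩) (⟨⟩-∘ₚ τ (flip π) k<m)) (⟨⟩-inverse (flip π) (⟨⟩-< τ k<m))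

module _ {m : ℕ} where

  Em-st : ∀ {n} (π : Permutation′ m) (σ : Permutation′ n) a → a + m ≤ n →
    st (factor σ a m) ≡ word π → Em π σ (suc a)
  Em-st π σ a a+m≤n eq = (s≤s z≤n , subst (suc a + m ≤_) (+-comm 1 _) (s≤s a+m≤n)) ,
    trans (cong st (word-factor σ a a+m≤n)) eq

  Em-st⁻¹ : ∀ {n} (π : Permutation′ m) (σ : Permutation′ n) {i} → Em π σ i →
    ∃[ a ] i ≡ suc a × a + m ≤ n × st (factor σ a m) ≡ word π
  Em-st⁻¹ {n} π σ {suc a} ((_ , i+m≤n+1) , eq) =
    a , refl , a+m≤n , trans (cong st (sym (word-factor σ a a+m≤n))) eq
    where
    a+m≤n : a + m ≤ n
    a+m≤n = s≤s⁻¹ (subst (suc a + m ≤_) (+-comm n 1) i+m≤n+1)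

  suffix-factor : ∀ (π : Permutation′ m) {d} → d ≤ m → word π [ d + 1 ⋯ m ] ≡ factor π d (m ∸ d)
  suffix-factor π {d} d≤m = subst₂ (λ s e → word π [ s ⋯ e ] ≡ factor π d (m ∸ d))
    (+-comm 1 d) (m+[n∸m]≡n d≤m) (word-factor π d (≤-reflexive (m+[n∸m]≡n d≤m)))

  prefix-factor : ∀ (π : Permutation′ m) {d} → word π [ 1 ⋯ m ∸ d ] ≡ factor π 0 (m ∸ d)
  prefix-factor π {d} = word-factor π 0 (m∸n≤m m d)

  𝒪⇒≤ : ∀ (π : Permutation′ m) {d} → 𝒪 π d → d ≤ m
  𝒪⇒≤ π ((_ , d≤m∸1) , _) = ≤-trans d≤m∸1 (m∸n≤m m 1)

  -- Both standardizations in the definition of `𝒪` are lists of ranks; this compares their entries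
  -- at index `k`.
  𝒪-rank : ∀ (π : Permutation′ m) {d k} → 𝒪 π d → k < m ∸ d →
    rank (factor π d (m ∸ d)) (letter π (d + k)) ≡ rank (factor π 0 (m ∸ d)) (letter π k)
  𝒪-rank π {d} {k} d∈𝒪@(_ , eq) k< = applyUpTo-injective (m ∸ d) (begin
    applyUpTo (λ j → rank (factor π d (m ∸ d)) (letter π (d + j))) (m ∸ d)  ≡⟨ st-applyUpTo _ (m ∸ d) ⟨
    st (factor π d (m ∸ d))                                                 ≡⟨ cong st (suffix-factor π (𝒪⇒≤ π d∈𝒪)) ⟨
    st (word π [ d + 1 ⋯ m ])                                               ≡⟨ eq ⟩
    st (word π [ 1 ⋯ m ∸ d ])                                               ≡⟨ cong st (prefix-factor π {d}) ⟩
    st (factor π 0 (m ∸ d))                                                 ≡⟨ st-applyUpTo _ (m ∸ d) ⟩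
    applyUpTo (λ j → rank (factor π 0 (m ∸ d)) (letter π j)) (m ∸ d)        ∎) k<
    where open ≡-Reasoning

  -- The positions shared by the two windows form a suffix of the first and a prefix of the second.
  -- By `st-factor-st`, the standardization of this common factor can be read off from `π` in both
  -- ways.
  Em-overlap : ∀ {n} (π : Permutation′ m) (σ : Permutation′ n) {a d} → 1 ≤ d → d < m →
    Em π σ (suc a) → Em π σ (suc (a + d)) → 𝒪 π d
  Em-overlap {n} π σ {a} {d} 1≤d d<m e e′ with Em-st⁻¹ π σ e | Em-st⁻¹ π σ e′
  ... | _ , refl , _ , eq | _ , refl , _ , eq′ = (1≤d , ∸-monoˡ-≤ 1 d<m) , (begin
    st (word π [ d + 1 ⋯ m ])                     ≡⟨ cong (λ w → st (w [ d + 1 ⋯ m ])) eq ⟨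
    st (st (factor σ a m) [ d + 1 ⋯ m ])          ≡⟨ st-factor-st (factor σ a m) (d + 1) m ⟩
    st (factor σ a m [ d + 1 ⋯ m ])               ≡⟨ cong st shared ⟩
    st (factor σ (a + d) m [ 1 ⋯ m ∸ d ])         ≡⟨ st-factor-st (factor σ (a + d) m) 1 (m ∸ d) ⟨
    st (st (factor σ (a + d) m) [ 1 ⋯ m ∸ d ])    ≡⟨ cong (λ w → st (w [ 1 ⋯ m ∸ d ])) eq′ ⟩
    st (word π [ 1 ⋯ m ∸ d ])                     ∎)
    where
    open ≡-Reasoning
    d+[m∸d]≡m : d + (m ∸ d) ≡ m
    d+[m∸d]≡m = m+[n∸m]≡n (<⇒≤ d<m)
    shift : ∀ {j} → j < m ∸ d → letter σ (a + (d + j)) ≡ letter σ (a + d + j)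
    shift {j} _ = cong (letter σ) (sym (+-assoc a d j))
    shared : factor σ a m [ d + 1 ⋯ m ] ≡ factor σ (a + d) m [ 1 ⋯ m ∸ d ]
    shared = begin
      factor σ a m [ d + 1 ⋯ m ]                                  ≡⟨ cong₂ (factor σ a m [_⋯_]) (+-comm d 1) (sym d+[m∸d]≡m) ⟩
      factor σ a m [ suc d ⋯ d + (m ∸ d) ]                        ≡⟨ applyUpTo-factor _ d (≤-reflexive d+[m∸d]≡m) ⟩
      applyUpTo (λ j → letter σ (a + (d + j))) (m ∸ d)            ≡⟨ applyUpTo-cong (m ∸ d) shift ⟩
      applyUpTo (λ j → letter σ (a + d + j)) (m ∸ d)              ≡⟨ applyUpTo-factor _ 0 (m∸n≤m m d) ⟨
      factor σ (a + d) m [ 1 ⋯ m ∸ d ]                            ∎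

  SameOverlaps : Permutation′ m → Permutation′ m → Set
  SameOverlaps π τ = 𝒪 π ≐ 𝒪 τ ×
    (∀ (i : ℕ) → 𝒪 π i →
      letters (word π [ 1 ⋯ m ∸ i ]) ≐ letters (word τ [ 1 ⋯ m ∸ i ])
      × letters (word π [ i + 1 ⋯ m ]) ≐ letters (word τ [ i + 1 ⋯ m ]))

  SameOverlaps-sym : ∀ {π τ} → SameOverlaps π τ → SameOverlaps τ π
  SameOverlaps-sym (𝒪≐ , letters≐) = swap 𝒪≐ , λ i i∈𝒪 →
    Product.map swap swap (letters≐ i (proj₂ 𝒪≐ i∈𝒪))

  -- The entry of τ at position k is the entry of π at position h k, h being the reindexing.
  -- Positions are determined by ranks within the prefix or the suffix, and the overlap d
  -- identifies the ranks in the prefix with those in the suffix, in π as in τ.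
  reindex-overlap : ∀ {π τ} → SameOverlaps π τ → ∀ {d k} → 𝒪 π d → d + k < m →
    reindex π τ ⟨ d + k ⟩ ≡ d + reindex π τ ⟨ k ⟩
  reindex-overlap {π} {τ} (𝒪≐ , letters≐) {d} {k} d∈𝒪 d+k<m =
    trans h[d+k]≡d+j (cong (d +_) j≡hk)
    where
    l = m ∸ d
    d≤m : d ≤ m
    d≤m = 𝒪⇒≤ π d∈𝒪
    d∈𝒪τ : 𝒪 τ d
    d∈𝒪τ = proj₁ 𝒪≐ d∈𝒪
    d+l≤m : d + l ≤ m
    d+l≤m = ≤-reflexive (m+[n∸m]≡n d≤m)
    <l⇒ : ∀ {j} → j < l → d + j < m
    <l⇒ j<l = <-≤-trans (+-monoʳ-< d j<l) d+l≤m
    k<l : k < l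
    k<l = +-cancelˡ-< d k l (<-≤-trans d+k<m (≤-reflexive (sym (m+[n∸m]≡n d≤m))))
    prefix≐ : letters (factor π 0 l) ≐ letters (factor τ 0 l)
    prefix≐ = subst₂ (λ v w → letters v ≐ letters w) (prefix-factor π {d}) (prefix-factor τ {d})
      (proj₁ (letters≐ d d∈𝒪))
    suffix≐ : letters (factor π d l) ≐ letters (factor τ d l)
    suffix≐ = subst₂ (λ v w → letters v ≐ letters w) (suffix-factor π d≤m) (suffix-factor τ d≤m)
      (proj₂ (letters≐ d d∈𝒪))
    h : ℕ → ℕ
    h = reindex π τ ⟨_⟩
    letter-h : ∀ {j} → j < m → letter π (h j) ≡ letter τ j
    letter-h j<m = cong suc (⟨reindex⟩ π τ j<m)
    h< : ∀ {j} → j < m → h j < m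
    h< = ⟨⟩-< (reindex π τ)
    letter-injective : ∀ {i j} → i < m → j < m → letter π i ≡ letter π j → i ≡ j
    letter-injective i<m j<m eq = ⟨⟩-injective π i<m j<m (suc-injective eq)
    k<m : k < m
    k<m = <-≤-trans k<l (m∸n≤m m d)
    hk<l : h k < l
    -- Letter `k` of `τ` lies in the prefix of `τ`, hence in that of `π`, so `h` keeps the prefix
    -- positions below `l`. This is what allows `𝒪-rank π` to be used at `h k`.
    hk<l with ∈-applyUpTo⁻ _ (proj₂ prefix≐ (∈-applyUpTo⁺ _ k<l))
    ... | j , j<l , eq = subst (_< l) (letter-injective (<-≤-trans j<l (m∸n≤m m d)) (h< k<m)
      (trans (sym eq) (sym (letter-h k<m)))) j<l
    -- Equality of the suffix letters yields only some offset `j`; the comparison of ranks then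
    -- identifies it with `h k`.
    suffix-index : ∃[ j ] j < l × letter τ (d + k) ≡ letter π (d + j)
    suffix-index = ∈-applyUpTo⁻ _ (proj₂ suffix≐ (∈-applyUpTo⁺ _ k<l))
    j = proj₁ suffix-index
    j<l : j < l
    j<l = proj₁ (proj₂ suffix-index)
    τ[d+k]≡π[d+j] : letter τ (d + k) ≡ letter π (d + j)
    τ[d+k]≡π[d+j] = proj₂ (proj₂ suffix-index)
    h[d+k]≡d+j : h (d + k) ≡ d + j
    h[d+k]≡d+j = letter-injective (h< d+k<m) (<l⇒ j<l) (trans (letter-h d+k<m) τ[d+k]≡π[d+j])
    open ≡-Reasoning
    prefix↭ : factor π 0 l ↭ factor τ 0 l
    prefix↭ = unique∧set⇒↭ (factor-unique π 0 (m∸n≤m m d)) (factor-unique τ 0 (m∸n≤m m d)) prefix≐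
    suffix↭ : factor π d l ↭ factor τ d l
    suffix↭ = unique∧set⇒↭ (factor-unique π d d+l≤m) (factor-unique τ d d+l≤m) suffix≐
    same-rank : rank (factor π d l) (letter π (d + j)) ≡ rank (factor π d l) (letter π (d + h k))
    same-rank = begin
      rank (factor π d l) (letter π (d + j))    ≡⟨ cong (rank (factor π d l)) τ[d+k]≡π[d+j] ⟨
      rank (factor π d l) (letter τ (d + k))    ≡⟨ rank-↭ suffix↭ _ ⟩
      rank (factor τ d l) (letter τ (d + k))    ≡⟨ 𝒪-rank τ d∈𝒪τ k<l ⟩
      rank (factor τ 0 l) (letter τ k)          ≡⟨ rank-↭ prefix↭ _ ⟨
      rank (factor π 0 l) (letter τ k)          ≡⟨ cong (rank (factor π 0 l)) (letter-h k<m) ⟨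
      rank (factor π 0 l) (letter π (h k))      ≡⟨ 𝒪-rank π d∈𝒪 hk<l ⟨
      rank (factor π d l) (letter π (d + h k))  ∎
    j≡hk : j ≡ h k
    j≡hk = +-cancelˡ-≡ d j (h k) (letter-injective (<l⇒ j<l) (<l⇒ hk<l)
      (rank-injective (∈-applyUpTo⁺ _ j<l) (∈-applyUpTo⁺ _ hk<l) same-rank))

-- Relabelling the positions of marked windows

module _ {m : ℕ} where

  covered? : ∀ (T : List ℕ) j → Dec (Any (λ a → a ≤ j × j < a + m) T)
  covered? T j = Any.any? (λ a → (a ≤? j) ×-dec (j <? a + m)) T

  -- Marked windows are listed by their zero-based starting positions: a ∈ T stands for an
  -- occurrence at suc a.
  relabel : Permutation′ m → List ℕ → ℕ → ℕ
  relabel η T j with covered? T j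
  -- The covering window `a` is an arbitrary choice; under `Coherent` the value does not depend on
  -- it, by `relabel-covered`.
  ... | yes c = let (a , _) = find c in a + η ⟨ j ∸ a ⟩
  ... | no  _ = j

  -- Two marked windows sharing a position prescribe the same new position.
  Coherent : Permutation′ m → List ℕ → Set
  Coherent η T = ∀ {a d k} → a ∈ T → a + d ∈ T → d + k < m → η ⟨ d + k ⟩ ≡ d + η ⟨ k ⟩

  -- Coherence at the offset `b ∸ a`, rephrased for one position written relative to two windows.
  Coherent-≤ : ∀ {η T} → Coherent η T → ∀ {a b k l} → a ∈ T → b ∈ T → k < m → a ≤ b → a + k ≡ b + l →
    a + η ⟨ k ⟩ ≡ b + η ⟨ l ⟩
  Coherent-≤ {η} {T} coh {a} {b} {k} {l} a∈T b∈T k<m a≤b eq = begin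
    a + η ⟨ k ⟩              ≡⟨ cong (λ k → a + η ⟨ k ⟩) k≡d+l ⟩
    a + η ⟨ (b ∸ a) + l ⟩    ≡⟨ cong (a +_) (coh a∈T (subst (_∈ T) (sym a+d≡b) b∈T) (subst (_< m) k≡d+l k<m)) ⟩
    a + ((b ∸ a) + η ⟨ l ⟩)  ≡⟨ +-assoc a (b ∸ a) (η ⟨ l ⟩) ⟨
    a + (b ∸ a) + η ⟨ l ⟩    ≡⟨ cong (_+ η ⟨ l ⟩) a+d≡b ⟩
    b + η ⟨ l ⟩              ∎
    where
    open ≡-Reasoning
    a+d≡b : a + (b ∸ a) ≡ b
    a+d≡b = m+[n∸m]≡n a≤b
    k≡d+l : k ≡ (b ∸ a) + l
    k≡d+l = +-cancelˡ-≡ a k ((b ∸ a) + l)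
      (trans eq (trans (cong (_+ l) (sym a+d≡b)) (+-assoc a (b ∸ a) l)))

  offset-< : ∀ {a j} → a ≤ j → j < a + m → j ∸ a < m
  offset-< {a} a≤j j<a+m = +-cancelˡ-< a _ m (subst (_< a + m) (sym (m+[n∸m]≡n a≤j)) j<a+m)

  relabel-covered : ∀ {η T} → Coherent η T → ∀ {a k} → a ∈ T → k < m → relabel η T (a + k) ≡ a + η ⟨ k ⟩
  relabel-covered {η} {T} coh {a} {k} a∈T k<m with covered? T (a + k)
  ... | no ¬c = contradiction (lose a∈T (m≤m+n a k , +-monoʳ-< a k<m)) ¬c
  ... | yes c with find c
  ...   | b , b∈T , b≤a+k , a+k<b+m with ≤-total a b
  ...     | inj₁ a≤b = sym (Coherent-≤ coh a∈T b∈T k<m a≤b (sym (m+[n∸m]≡n b≤a+k)))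
  ...     | inj₂ b≤a = Coherent-≤ coh b∈T a∈T
    (offset-< b≤a+k a+k<b+m) b≤a (m+[n∸m]≡n b≤a+k)

  relabel-uncovered : ∀ {η T j} → ¬ Any (λ a → a ≤ j × j < a + m) T → relabel η T j ≡ j
  relabel-uncovered {η} {T} {j} ¬c with covered? T j
  ... | yes c = contradiction c ¬c
  ... | no  _ = refl

  -- A covered position moves within its window, so the same window covers its image and `flip η`
  -- undoes the move there. Uncovered positions are fixed.
  relabel-inverse : ∀ {η T} → Coherent η T → Coherent (flip η) T → ∀ j →
    relabel (flip η) T (relabel η T j) ≡ j
  relabel-inverse {η} {T} coh coh⁻¹ j with covered? T j
  ... | no ¬c = relabel-uncovered ¬c
  ... | yes c with find c
  ...   | a , a∈T , a≤j , j<a+m = begin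
    relabel (flip η) T (a + η ⟨ j ∸ a ⟩)  ≡⟨ relabel-covered coh⁻¹ a∈T (⟨⟩-< η k<m) ⟩
    a + flip η ⟨ η ⟨ j ∸ a ⟩ ⟩            ≡⟨ cong (a +_) (⟨⟩-inverse η k<m) ⟩
    a + (j ∸ a)                           ≡⟨ m+[n∸m]≡n a≤j ⟩
    j                                     ∎
    where
    open ≡-Reasoning
    k<m : j ∸ a < m
    k<m = offset-< a≤j j<a+m

  relabel-< : ∀ {n η T} → All (λ a → a + m ≤ n) T → ∀ {j} → j < n → relabel η T j < n
  relabel-< {n} {η} {T} fits {j} j<n with covered? T j
  ... | no _  = j<n
  ... | yes c with find c
  ...   | a , a∈T , a≤j , j<a+m = <-≤-trans (+-monoʳ-< a (⟨⟩-< η k<m)) (All.lookup fits a∈T)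
    where
    k<m : j ∸ a < m
    k<m = offset-< a≤j j<a+m

  module _ {n} {η : Permutation′ m} {T : List ℕ}
    (fits : All (λ a → a + m ≤ n) T) (coh : Coherent η T) (coh⁻¹ : Coherent (flip η) T) where

    relabelling : Permutation′ n
    relabelling = permutation
      (λ i → fromℕ< (relabel-< {η = η} fits (Fin.toℕ<n i)))
      (λ i → fromℕ< (relabel-< {η = flip η} fits (Fin.toℕ<n i)))
      (λ i → Fin.toℕ-injective (trans (Fin.toℕ-fromℕ< _)
        (trans (cong (relabel η T) (Fin.toℕ-fromℕ< _)) (relabel-inverse {flip η} coh⁻¹ coh (toℕ i)))))
      (λ i → Fin.toℕ-injective (trans (Fin.toℕ-fromℕ< _)
        (trans (cong (relabel (flip η) T) (Fin.toℕ-fromℕ< _)) (relabel-inverse {η} coh coh⁻¹ (toℕ i)))))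

    ⟨relabelling⟩ : ∀ {a k} → a ∈ T → k < m → relabelling ⟨ a + k ⟩ ≡ a + η ⟨ k ⟩
    ⟨relabelling⟩ {a} {k} a∈T k<m = trans
      (⟨⟩-fromℕ< relabelling (<-≤-trans (+-monoʳ-< a k<m) (All.lookup fits a∈T)))
      (trans (Fin.toℕ-fromℕ< _)
        (trans (cong (relabel η T) (Fin.toℕ-fromℕ< _)) (relabel-covered coh a∈T k<m)))

  -- In a marked window, relabelling only rearranges the letters of `σ` by h. The rank of a letter
  -- is insensitive to rearrangement, so the rank at `k` is the letter of `π` at `h k`, which is the
  -- letter of `τ` at `k`.
  Em-relabelling : ∀ {n} {π τ : Permutation′ m} {σ : Permutation′ n} {T}
    (fits : All (λ a → a + m ≤ n) T) (coh : Coherent (reindex π τ) T)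
    (coh⁻¹ : Coherent (flip (reindex π τ)) T) →
    ∀ {a} → a ∈ T → Em π σ (suc a) → Em τ (relabelling fits coh coh⁻¹ ∘ₚ σ) (suc a)
  Em-relabelling {n} {π} {τ} {σ} fits coh coh⁻¹ {a} a∈T e with Em-st⁻¹ π σ e
  ... | _ , refl , a+m≤n , eq = Em-st τ (γ ∘ₚ σ) a a+m≤n (begin
    st (factor (γ ∘ₚ σ) a m)                      ≡⟨ cong st (applyUpTo-cong m letter-γ) ⟩
    st (applyUpTo (λ k → F (h k)) m)              ≡⟨ st-applyUpTo (λ k → F (h k)) m ⟩
    applyUpTo (λ k → rank (applyUpTo (λ k → F (h k)) m) (F (h k))) m
                                                  ≡⟨ applyUpTo-cong m (λ _ → rank-↭ (applyUpTo-permute (reindex π τ) F) _) ⟩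
    applyUpTo (λ k → rank (applyUpTo F m) (F (h k))) m
                                                  ≡⟨ applyUpTo-cong m rank-Fh ⟩
    applyUpTo (letter τ) m                        ≡⟨ word-applyUpTo τ ⟨
    word τ                                        ∎)
    where
    open ≡-Reasoning
    γ : Permutation′ n
    γ = relabelling fits coh coh⁻¹
    h F : ℕ → ℕ
    h k = reindex π τ ⟨ k ⟩
    F k = letter σ (a + k)
    rank-F : ∀ {k} → k < m → rank (applyUpTo F m) (F k) ≡ letter π k
    rank-F = applyUpTo-injective m (trans (sym (st-applyUpTo F m)) (trans eq (word-applyUpTo π)))
    rank-Fh : ∀ {k} → k < m → rank (applyUpTo F m) (F (h k)) ≡ letter τ k
    rank-Fh k<m = trans (rank-F (⟨⟩-< (reindex π τ) k<m)) (cong suc (⟨reindex⟩ π τ k<m))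
    letter-γ : ∀ {k} → k < m → letter (γ ∘ₚ σ) (a + k) ≡ F (h k)
    letter-γ k<m = cong suc (trans (⟨⟩-∘ₚ γ σ (<-≤-trans (+-monoʳ-< a k<m) a+m≤n))
      (cong (σ ⟨_⟩) (⟨relabelling⟩ fits coh coh⁻¹ a∈T k<m)))

  -- The trace that an occurrence of `π` at all of `T` leaves once `σ` is forgotten; in this form it
  -- passes from `π` to `τ` along the equality of overlap sets. The offset is a successor because
  -- `𝒪` contains positive numbers only.
  Overlapping : Permutation′ m → List ℕ → Set
  Overlapping π T = ∀ {a d} → a ∈ T → a + suc d ∈ T → suc d < m → 𝒪 π (suc d)

  Em-overlapping : ∀ {n} (π : Permutation′ m) (σ : Permutation′ n) {T} →
    All (λ a → Em π σ (suc a)) T → Overlapping π T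
  Em-overlapping π σ ems a∈T a+d∈T d<m =
    Em-overlap π σ (s≤s z≤n) d<m (All.lookup ems a∈T) (All.lookup ems a+d∈T)

  reindex-coherent : ∀ {π τ : Permutation′ m} {T} → SameOverlaps π τ → Overlapping π T →
    Coherent (reindex π τ) T
  reindex-coherent same ov {d = zero}  a∈T a+d∈T d+k<m = refl
  reindex-coherent {π} {τ} same ov {d = suc d} {k} a∈T a+d∈T d+k<m =
    reindex-overlap {π = π} {τ} same (ov a∈T a+d∈T (≤-<-trans (m≤m+n (suc d) k) d+k<m)) d+k<m

-- Counting permutations with prescribed occurrences

  Em-cong : ∀ {n} (π : Permutation′ m) {i} → (λ (σ : Permutation′ n) → Em π σ i) Respects _≈_
  Em-cong π {i} σ≈ρ (bounds , eq) =
    bounds , trans (cong (λ w → st (w [ i ⋯ i + m ∸ 1 ]))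
      (tabulate-cong λ j → cong (suc ∘ toℕ) (sym (σ≈ρ j)))) eq

  Em? : ∀ {n} (π : Permutation′ m) (σ : Permutation′ n) i → Dec (Em π σ i)
  Em? {n} π σ i = ((1 ≤? i) ×-dec (i + m ≤? n + 1)) ×-dec ≡-dec _≟_ _ _

  -- Occurrences are forced at `T`, forbidden at `V` and left free elsewhere; both lists hold
  -- zero-based starting positions.
  Prescribed : ∀ {n} → Permutation′ m → List ℕ → List ℕ → Pred (Permutation′ n) 0ℓ
  Prescribed π T V σ = All (λ a → Em π σ (suc a)) T × All (λ a → ¬ Em π σ (suc a)) V

  Prescribed-card : ∀ {n} (π : Permutation′ m) T V → ∃[ k ] HasCardinality {n} (Prescribed π T V) k
  Prescribed-card π T V = HasCardinality-∃
    (λ σ → All.all? (λ a → Em? π σ (suc a)) T ×-dec All.all? (λ a → ¬? (Em? π σ (suc a))) V)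
    (λ {σ} {ρ} eq (ts , vs) →
      All.map (Em-cong π {_} {σ} {ρ} eq) ts ,
      All.map (λ ¬e e → ¬e (Em-cong π {_} {ρ} {σ} (λ i → sym (eq i)) e)) vs)

  module _ {n : ℕ} where

    -- One listed `σ` witnesses that the windows of `T` fit into [n] and meet only at overlaps of
    -- `π`. The resulting `γ` depends on `T` and not on `σ`, so it serves for all listed
    -- permutations at once.
    Prescribed-≤ : ∀ {π τ} → SameOverlaps π τ → ∀ T {k l} →
      HasCardinality {n} (Prescribed π T []) k → HasCardinality {n} (Prescribed τ T []) l → k ≤ l
    -- With no witness `γ` may not exist, but then `k` is zero.
    Prescribed-≤ {π} {τ} same T ([] , refl , _) _ = z≤n
    Prescribed-≤ {π} {τ} same T c@(σ ∷ _ , _ , _ , P⇔) d = HasCardinality-mono (γ ∘ₚ_)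
      -- Composition with `γ` on the position side is cancelled by evaluating at `flip γ`.
      (λ {ρ} {ρ′} eq i → trans (cong (ρ ⟨$⟩ʳ_) (sym (inverseʳ γ)))
        (trans (eq (flip γ ⟨$⟩ʳ i)) (cong (ρ′ ⟨$⟩ʳ_) (inverseʳ γ))))
      (λ {ρ} (ems , _) →
        All.tabulate (λ a∈T → Em-relabelling {π = π} {τ} {ρ} fits coh coh⁻¹ a∈T (All.lookup ems a∈T)) , [])
      c d
      where
      ems : All (λ a → Em π σ (suc a)) T
      ems = proj₁ (Equivalence.from (P⇔ σ) (here λ _ → refl))
      fits : All (λ a → a + m ≤ n) T
      fits = All.map (λ e → let (_ , eq , a+m≤n , _) = Em-st⁻¹ π σ e in
        subst (λ a → a + m ≤ n) (sym (suc-injective eq)) a+m≤n) ems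
      ov : Overlapping π T
      ov = Em-overlapping π σ ems
      coh : Coherent (reindex π τ) T
      coh = reindex-coherent {π} {τ} same ov
      -- By computation, `reindex τ π` has the same values as `flip (reindex π τ)`, so exchanging
      -- `π` and `τ` gives the coherence of the inverse.
      coh⁻¹ : Coherent (reindex τ π) T
      coh⁻¹ = reindex-coherent {τ} {π} (SameOverlaps-sym {π = π} {τ} same)
        (λ a∈T a+d∈T d<m → proj₁ (proj₁ same) (ov a∈T a+d∈T d<m))
      γ : Permutation′ n
      γ = relabelling fits coh coh⁻¹

    Prescribed-split : ∀ α T v V → ∃[ a ] ∃[ b ] HasCardinality {n} (Prescribed α T V) (a + b)
      × HasCardinality {n} (Prescribed α (v ∷ T) V) a × HasCardinality {n} (Prescribed α T (v ∷ V)) b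
    Prescribed-split α T v V with Prescribed-card α T V
    ... | _ , total with HasCardinality-split (λ σ → Em? α σ (suc v)) (λ {σ} {ρ} → Em-cong α {_} {σ} {ρ}) total
    ...   | a , b , with-v , without-v , refl = a , b , total ,
        HasCardinality-resp-≐
          ((λ ((ts , vs) , e) → e ∷ ts , vs) , (λ { (e ∷ ts , vs) → (ts , vs) , e })) with-v ,
        HasCardinality-resp-≐
          ((λ ((ts , vs) , ¬e) → ts , ¬e ∷ vs) , (λ { (ts , ¬e ∷ vs) → (ts , vs) , ¬e })) without-v

    -- Induction on `V` for all `T` at once, as the subtracted term moves `v` from `V` to `T`. The
    -- subtraction is carried out by cancelling equal summands.
    Prescribed-≡ : ∀ {π τ} → SameOverlaps π τ → ∀ T V {k l} →
      HasCardinality {n} (Prescribed π T V) k → HasCardinality {n} (Prescribed τ T V) l → k ≡ l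
    Prescribed-≡ {π} {τ} same T [] c d =
      ≤-antisym (Prescribed-≤ {π} {τ} same T c d)
        (Prescribed-≤ {τ} {π} (SameOverlaps-sym {π = π} {τ} same) T d c)
    Prescribed-≡ {π} {τ} same T (v ∷ V) {k} {l} c d
      with k₁ , k₂ , k₁+k₂ , c₁ , c₂ ← Prescribed-split π T v V
         | l₁ , l₂ , l₁+l₂ , d₁ , d₂ ← Prescribed-split τ T v V = begin
      k   ≡⟨ HasCardinality-unique c c₂ ⟩
      k₂  ≡⟨ +-cancelˡ-≡ k₁ k₂ l₂ (begin
        k₁ + k₂  ≡⟨ Prescribed-≡ {π} {τ} same T V k₁+k₂ l₁+l₂ ⟩
        l₁ + l₂  ≡⟨ cong (_+ l₂) (Prescribed-≡ {π} {τ} same (v ∷ T) V c₁ d₁) ⟨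
        k₁ + l₂  ∎) ⟩
      l₂  ≡⟨ HasCardinality-unique d₂ d ⟩
      l   ∎
      where
      open ≡-Reasoning

    -- The bound avoids `m`; it must admit `a` equal to `n`, which occurs when `m` is zero. It makes
    -- `Em` a matter of finitely many positions.
    Em-bounded : ∀ (π : Permutation′ m) (σ : Permutation′ n) {i} → Em π σ i →
      ∃[ a ] i ≡ suc a × a < suc n
    Em-bounded π σ e = let (a , eq , a+m≤n , _) = Em-st⁻¹ π σ e in a , eq , s≤s (m+n≤o⇒m≤o a a+m≤n)

    inside outside : ∀ {S : Pred ℕ 0ℓ} → (∀ a → Dec (S (suc a))) → List ℕ
    inside  S? = filter S? (upTo (suc n))
    outside S? = filter (¬? ∘ S?) (upTo (suc n))

    -- Every starting position below `suc n` is either forced or forbidden, and beyond that range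
    -- neither `S` nor `Em` has elements.
    Em≐-Prescribed : ∀ {S : Pred ℕ 0ℓ} (S? : ∀ a → Dec (S (suc a))) →
      (∀ {i} → S i → ∃[ a ] i ≡ suc a × a < suc n) → ∀ (π : Permutation′ m) →
      (λ (σ : Permutation′ n) → Em π σ ≐ S) ≐
        Prescribed π (inside {S} S?) (outside {S} S?)
    Em≐-Prescribed {S} S? bounded π =
      (λ (Em⊆S , S⊆Em) → All.map S⊆Em (all-filter S? _) ,
        All.map (λ ¬s e → ¬s (Em⊆S e)) (all-filter (¬? ∘ S?) _)) ,
      λ {σ} (ts , vs) → Em⊆S σ vs , S⊆Em σ ts
      where
      Em⊆S : ∀ σ → All (λ a → ¬ Em π σ (suc a)) (outside {S} S?) → Em π σ ⊆ S
      Em⊆S σ vs e with Em-bounded π σ e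
      ... | a , refl , a<1+n = decidable-stable (S? a) λ ¬s →
        All.lookup vs (∈-filter⁺ (¬? ∘ S?) (∈-upTo⁺ a<1+n) ¬s) e
      S⊆Em : ∀ σ → All (λ a → Em π σ (suc a)) (inside {S} S?) → S ⊆ Em π σ
      S⊆Em σ ts s with bounded s
      ... | a , refl , a<1+n = All.lookup ts (∈-filter⁺ S? (∈-upTo⁺ a<1+n) s)

    -- A set of the form `Em α ρ` is decidable and bounded. The pattern `α` is kept general because
    -- `a-transfer` needs it to be `π` in one case and `τ` in the other.
    a-transfer-realised : ∀ {π τ} → SameOverlaps π τ → ∀ {S k} (α : Permutation′ m) (ρ : Permutation′ n) →
      Em α ρ ≐ S → a[ π , n , S ]≡ k → a[ τ , n , S ]≡ k
    a-transfer-realised {π} {τ} same {S} {k} α ρ (Em⊆S , S⊆Em) c =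
      let (l , d) = Prescribed-card {n} τ (inside {S} S?) (outside {S} S?) in
      subst (a[ τ , n , S ]≡_)
        (sym (Prescribed-≡ {π} {τ} same _ _ (HasCardinality-resp-≐ (prescribed π) c) d))
        (HasCardinality-resp-≐ (swap (prescribed τ)) d)
      where
      S? : ∀ a → Dec (S (suc a))
      S? a = map′ Em⊆S S⊆Em (Em? α ρ (suc a))
      prescribed : ∀ π → (λ (σ : Permutation′ n) → Em π σ ≐ S) ≐
        Prescribed π (inside {S} S?) (outside {S} S?)
      prescribed = Em≐-Prescribed S? (Em-bounded α ρ ∘ S⊆Em)

    -- S need not be decidable, but it is as soon as some permutation realises it; if none does
    -- for π, then none does for τ either.
    a-transfer : ∀ {π τ} → SameOverlaps π τ → ∀ {S k} → a[ π , n , S ]≡ k → a[ τ , n , S ]≡ k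
    a-transfer {π} {τ} same c@(σ ∷ _ , _ , _ , P⇔) =
      a-transfer-realised {π} {τ} same π σ (Equivalence.from (P⇔ σ) (here λ _ → refl)) c
    a-transfer {π} {τ} same c@([] , refl , _) = [] , refl , [] , λ ρ → mk⇔
      -- A `ρ` realising `S` for `τ` would make `S` decidable, so the count zero for `π` would carry
      -- over to `τ`, against the existence of `ρ`.
      (λ eq → empty {ρ = ρ} (a-transfer-realised {π} {τ} same τ ρ eq c) eq) (λ ())
      where
      empty : ∀ {P : Pred (Permutation′ n) 0ℓ} {ρ} → HasCardinality P 0 → P ρ → Any (ρ ≈_) []
      empty {ρ = ρ} ([] , _ , _ , P⇔) p = Equivalence.to (P⇔ ρ) p

theorem1p11 : ∀ (m : ℕ) (π τ : Permutation′ m) →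
    𝒪 π ≐ 𝒪 τ →
    (∀ (i : ℕ) → 𝒪 π i →
    letters (word π [ 1 ⋯ m ∸ i ]) ≐ letters (word τ [ 1 ⋯ m ∸ i ])
    × letters (word π [ i + 1 ⋯ m ]) ≐ letters (word τ [ i + 1 ⋯ m ])) →
    SuperStronglyCWilfEquivalent π τ
theorem1p11 m π τ 𝒪≐ letters≐ n S _ k =
  mk⇔ (a-transfer {π = π} {τ} same) (a-transfer {π = τ} {π} (SameOverlaps-sym {π = π} {τ} same))
  where
  same : SameOverlaps π τ
  same = 𝒪≐ , letters≐
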